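{- Let $P$ be a poset and let $\to$ be a total binary operation on $P$. Then $\to$ is an extended sectional pseudocomplementation on $P$ if and only if the following three conditions hold for all $x,y,z\in P$: (1) if $z\le x\le y$, then $y\to z\le x\to z$; (2) if $y\le x\le x\to y$, then $x\le y$; (3) if $z$ is a maximal lower bound of $x$ and $y$, then $x\le y\to z$.
   Context: For a poset $P$ and $y\in P$ put $[y)=\{u\in P: y\le u\}$. For $x,y,p \in P$, $x\wedge_p y=z$ means that $p\le x,y$ and $z$ is the greatest element of the set of common lower bounds of $x$ and $y$ lying in $[p)$. For $y\le x$, a pseudocomplement of $x$ in $[y)$ is the greatest element of $\{u\in P: u\wedge_y x=y\}$, i.e. the greatest $u\ge y$ such that $y$ is the only common lower bound of $u$ and $x$ in $[y)$. A total binary operation $\to$ on $P$ is an extended sectional pseudocomplementation if, for all $x,y$ with $y\le x$, $x\to y$ is the pseudocomplement of $x$ in $[y)$ (in particular this pseudocomplement exists); no condition is imposed on $x\to y$ when $y\not\le x$. A maximal lower bound of $x$ and $y$ is a maximal element of the set of common lower bounds of $x$ and $y$ in $P$. -}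

module Defs where

open import Algebra.Core using (Op₂)
open import Data.Product using (_×_)
open import Level using (Level; _⊔_)
open import Relation.Binary.Bundles using (Poset)
open import Relation.Unary using (Pred; _∈_; _∩_)

module SectionalPseudocomplementation {c ℓ₁ ℓ₂ : Level} (P : Poset c ℓ₁ ℓ₂) where

  open Poset P

  IsGreatest : ∀ {ℓ} → Pred Carrier ℓ → Pred Carrier (c ⊔ ℓ ⊔ ℓ₂)
  IsGreatest S z = z ∈ S × (∀ w → w ∈ S → w ≤ z)

  IsMaximal : ∀ {ℓ} → Pred Carrier ℓ → Pred Carrier (c ⊔ ℓ ⊔ ℓ₁ ⊔ ℓ₂)
  IsMaximal S z = z ∈ S × (∀ w → w ∈ S → z ≤ w → z ≈ w)

  [_⟩ : Carrier → Pred Carrier ℓ₂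
  [ y ⟩ u = y ≤ u

  CommonLowerBounds : Carrier → Carrier → Pred Carrier ℓ₂
  CommonLowerBounds x y u = u ≤ x × u ≤ y

  IsMaximalLowerBound : Carrier → Carrier → Pred Carrier (c ⊔ ℓ₁ ⊔ ℓ₂)
  IsMaximalLowerBound x y = IsMaximal (CommonLowerBounds x y)

  -- x ∧[ p ] y ≐ z : the partial meet of x and y in [ p ⟩ is defined and
  -- equals z.
  _∧[_]_≐_ : Carrier → Carrier → Carrier → Carrier → Set (c ⊔ ℓ₂)
  x ∧[ p ] y ≐ z =
    p ≤ x × p ≤ y × IsGreatest (CommonLowerBounds x y ∩ [ p ⟩) z

  -- w is the pseudocomplement of x in [ y ⟩; only meaningful for y ≤ x.
  IsPseudocomplementIn : Carrier → Carrier → Pred Carrier (c ⊔ ℓ₂)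
  IsPseudocomplementIn x y = IsGreatest (λ u → u ∧[ y ] x ≐ y)

  IsExtendedSectionalPseudocomplementation : Op₂ Carrier → Set (c ⊔ ℓ₂)
  IsExtendedSectionalPseudocomplementation _⇒_ =
    ∀ x y → y ≤ x → IsPseudocomplementIn x y (x ⇒ y)

{-# OPTIONS --safe #-}
module Submission where

open import Algebra.Core using (Op₂)
open import Algebra.Definitions using (Congruent₂)
open import Data.Product using (_×_; _,_; proj₁; proj₂)
open import Function.Bundles using (_⇔_; mk⇔)
open import Relation.Binary.Bundles using (Poset)
open import Defs

-- Since `z` is the least element of `[ z ⟩`, it is the greatest common lower bound there exactly
-- when it is the only one, that is, a maximal lower bound. So (3) says that `y ⇒ z` bounds every
-- `u` with `u ∧[ z ] y ≐ z`; (1) and (2) serve to show that `x ⇒ y` is itself such an element for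
-- `x` over `y`.

module _ {c ℓ₁ ℓ₂} (P : Poset c ℓ₁ ℓ₂) where
  open Poset P
  open SectionalPseudocomplementation P

  maximalLowerBound⇒meet : ∀ {x y z} → IsMaximalLowerBound x y z → x ∧[ z ] y ≐ z
  maximalLowerBound⇒meet ((z≤x , z≤y) , max) =
    z≤x , z≤y , ((z≤x , z≤y) , refl) ,
    λ { w (w≤x,y , z≤w) → reflexive (Eq.sym (max w w≤x,y z≤w)) }

  meet⇒maximalLowerBound : ∀ {x y z} → x ∧[ z ] y ≐ z → IsMaximalLowerBound x y z
  meet⇒maximalLowerBound (z≤x , z≤y , _ , greatest) =
    (z≤x , z≤y) , λ w w≤x,y z≤w → antisym z≤w (greatest w (w≤x,y , z≤w))

  -- Replacing `y` by a smaller `x` can only remove common lower bounds, and `z` survives because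
  -- `z ≤ x`. This is what makes pseudocomplements antitone.
  meet-antitoneʳ : ∀ {u x y z} → z ≤ x → x ≤ y → u ∧[ z ] y ≐ z → u ∧[ z ] x ≐ z
  meet-antitoneʳ z≤x x≤y (z≤u , _ , _ , greatest) =
    z≤u , z≤x , ((z≤u , z≤x) , refl) ,
    λ { w ((w≤u , w≤x) , z≤w) → greatest w ((w≤u , trans w≤x x≤y) , z≤w) }

  -- Fed to (3), this yields `y ≤ x ⇒ y`, placing `x ⇒ y` in the section `[ y ⟩`.
  ≤⇒maximalLowerBound : ∀ {x y} → y ≤ x → IsMaximalLowerBound y x y
  ≤⇒maximalLowerBound y≤x = (refl , y≤x) , λ { w (w≤y , _) y≤w → antisym y≤w w≤y }

proposition3p2 : ∀ {c ℓ₁ ℓ₂} (P : Poset c ℓ₁ ℓ₂) →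
    let open Poset P
        open SectionalPseudocomplementation P
    in
    (_⇒_ : Op₂ Carrier) → Congruent₂ _≈_ _⇒_ →
    IsExtendedSectionalPseudocomplementation _⇒_ ⇔
      ((∀ x y z → z ≤ x → x ≤ y → (y ⇒ z) ≤ (x ⇒ z)) ×
       (∀ x y → y ≤ x → x ≤ (x ⇒ y) → x ≤ y) ×
       (∀ x y z → IsMaximalLowerBound x y z → x ≤ (y ⇒ z)))
proposition3p2 P _⇒_ _ = mk⇔
  (λ (pc : IsExtendedSectionalPseudocomplementation _⇒_) →
    (λ x y z z≤x x≤y →
      proj₂ (pc x z z≤x) (y ⇒ z)
        (meet-antitoneʳ P z≤x x≤y (proj₁ (pc y z (trans z≤x x≤y))))) ,
    (λ x y y≤x x≤x⇒y →
      let (_ , _ , _ , greatest) , _ = pc x y y≤x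
      -- Here `x` itself is a common lower bound of `x ⇒ y` and `x` in `[ y ⟩`, where `y` is the
      -- greatest.
      in greatest x ((x≤x⇒y , refl) , y≤x)) ,
    (λ x y z mlb →
      proj₂ (pc y z (proj₂ (proj₁ mlb))) x (maximalLowerBound⇒meet P mlb)))
  (λ { (antitone , below , above) x y y≤x →
    let y≤x⇒y = above y x y (≤⇒maximalLowerBound P y≤x)
    in (y≤x⇒y , y≤x , ((y≤x⇒y , y≤x) , refl) ,
        -- w ≤ x ⇒ y ≤ w ⇒ y by antitonicity, so the second condition applies to w
        λ { w ((w≤x⇒y , w≤x) , y≤w) →
              below w y y≤w (trans w≤x⇒y (antitone w x y y≤w w≤x)) }) ,
       λ u meet → above u x y (meet⇒maximalLowerBound P meet) })
  where
  open Poset P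
  open SectionalPseudocomplementation P
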